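{- Let $G$ be a directed graph that is a disjoint union of directed paths, with an arbitrary coloring of its vertices by uncolored/red/blue, and let $M$ be the corresponding \textsc{Myopic Col} position. Then $M = a \times * + b - c$, where $a$ is the number of uncolored vertices that either have no outgoing arc or whose outgoing arc leads to an uncolored vertex, $b$ is the number of uncolored vertices whose outgoing arc leads to a red vertex, and $c$ is the number of uncolored vertices whose outgoing arc leads to a blue vertex.
   Context: \textsc{Myopic Col} is a partizan combinatorial game under normal play (a player unable to move loses). A position is a directed graph $(V,E)$ together with a coloring $c : V \to \{\text{uncolored}, \text{red}, \text{blue}\}$. On a turn, a player of color $A \in \{\text{red}, \text{blue}\}$ chooses a vertex $v$ with $c(v) = \text{uncolored}$ such that there is no arc $(v, b) \in E$ with $c(b) = A$, and recolors $v$ with $A$; the graph is unchanged. Blue is the Left player and Red is the Right player. Values are standard combinatorial game values; $*=\{0\mid 0\}$ and $m \times *$ denotes the sum of $m$ copies of $*$. In a disjoint union of directed paths every vertex has at most one outgoing arc. -}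

module Defs where

open import Data.Nat using (ℕ; zero; suc; _+_)
open import Data.Fin using (Fin; splitAt; _≟_)
open import Data.Sum using ([_,_]′)
open import Data.Product using (Σ)
open import Data.Bool using (Bool; true; false; _∧_; _∨_; not; if_then_else_)
open import Data.List using (List; length; lookup; allFin; filterᵇ)
open import Data.Bool.ListAction using (any)
open import Relation.Nullary using (¬_; does)
open import Relation.Binary.PropositionalEquality using (_≡_)
open import Relation.Binary.Construct.Closure.Transitive using (TransClosure)

data Game : Set where
  mk : (nL : ℕ) → (Fin nL → Game) → (nR : ℕ) → (Fin nR → Game) → Game

LeftWinsFirst  : Game → Set
RightWinsFirst : Game → Set
LeftWinsFirst  (mk nL L nR R) = Σ (Fin nL) λ i → ¬ RightWinsFirst (L i)
RightWinsFirst (mk nL L nR R) = Σ (Fin nR) λ j → ¬ LeftWinsFirst (R j)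

pick : {A : Set} (n m : ℕ) → (Fin n → A) → (Fin m → A) → Fin (n + m) → A
pick n m f g i = [ f , g ]′ (splitAt n i)

infixl 6 _⊕_
_⊕_ : Game → Game → Game
G@(mk nL L nR R) ⊕ H@(mk mL L' mR R') =
  mk (nL + mL) (pick nL mL (λ a → L a ⊕ H) (λ b → G ⊕ L' b))
     (nR + mR) (pick nR mR (λ a → R a ⊕ H) (λ b → G ⊕ R' b))

neg : Game → Game
neg (mk nL L nR R) = mk nR (λ j → neg (R j)) nL (λ i → neg (L i))

infix 4 _≈_
_≈_ : Game → Game → Set
G ≈ H = ¬ LeftWinsFirst (G ⊕ neg H) Data.Product.× ¬ RightWinsFirst (G ⊕ neg H)

zeroG : Game
zeroG = mk 0 (λ ()) 0 (λ ())

star : Game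
star = mk 1 (λ _ → zeroG) 1 (λ _ → zeroG)

natG : ℕ → Game
natG zero    = zeroG
natG (suc n) = mk 1 (λ _ → natG n) 0 (λ ())

times : ℕ → Game → Game
times zero    G = zeroG
times (suc m) G = G ⊕ times m G

data Color : Set where
  uncolored red blue : Color

_==_ : Color → Color → Bool
uncolored == uncolored = true
red       == red       = true
blue      == blue      = true
_         == _         = false

Digraph : ℕ → Set
Digraph n = Fin n → Fin n → Bool

Arc : ∀ {n} → Digraph n → Fin n → Fin n → Set
Arc E v w = E v w ≡ true

-- Disjoint union of directed paths: out-degree ≤ 1, in-degree ≤ 1, and no
-- directed cycle (including loops).
IsDisjointUnionOfPaths : ∀ {n} → Digraph n → Set
IsDisjointUnionOfPaths {n} E =
  (∀ v w w' → Arc E v w → Arc E v w' → w ≡ w') Data.Product.×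
  (∀ v v' w → Arc E v w → Arc E v' w → v ≡ v') Data.Product.×
  (∀ v → ¬ TransClosure (Arc E) v v)

legal : ∀ {n} → Digraph n → (Fin n → Color) → Color → Fin n → Bool
legal {n} E c A v =
  (c v == uncolored) ∧ not (any (λ b → E v b ∧ (c b == A)) (allFin n))

recolor : ∀ {n} → (Fin n → Color) → Fin n → Color → (Fin n → Color)
recolor c v A w = if does (w ≟ v) then A else c w

-- Game tree with fuel. Each move colours one uncolored vertex, so fuel n
-- (the number of vertices) is always enough: the exact position is
-- myopicCol E c = myopicColFuel n E c.
myopicColFuel : ∀ {n} → ℕ → Digraph n → (Fin n → Color) → Game
myopicColFuel zero E c = zeroG
myopicColFuel {n} (suc k) E c =
  mk (length ls) (λ i → myopicColFuel k E (recolor c (lookup ls i) blue))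
     (length rs) (λ j → myopicColFuel k E (recolor c (lookup rs j) red))
  where
  ls = filterᵇ (legal E c blue) (allFin n)   -- Blue = Left
  rs = filterᵇ (legal E c red)  (allFin n)   -- Red  = Right

myopicCol : ∀ {n} → Digraph n → (Fin n → Color) → Game
myopicCol {n} E c = myopicColFuel n E c

countV : ∀ {n} → (Fin n → Bool) → ℕ
countV {n} p = length (filterᵇ p (allFin n))

hasOutArc : ∀ {n} → Digraph n → Fin n → Bool
hasOutArc {n} E v = any (λ w → E v w) (allFin n)

hasArcTo : ∀ {n} → Digraph n → (Fin n → Color) → Color → Fin n → Bool
hasArcTo {n} E c A v = any (λ w → E v w ∧ (c w == A)) (allFin n)

countA : ∀ {n} → Digraph n → (Fin n → Color) → ℕ
countA E c = countV (λ v → (c v == uncolored) ∧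
                            (not (hasOutArc E v) ∨ hasArcTo E c uncolored v))

countB : ∀ {n} → Digraph n → (Fin n → Color) → ℕ
countB E c = countV (λ v → (c v == uncolored) ∧ hasArcTo E c red v)

countC : ∀ {n} → Digraph n → (Fin n → Color) → ℕ
countC E c = countV (λ v → (c v == uncolored) ∧ hasArcTo E c blue v)

-- The position equals an integer plus 0 or *, namely the sum over the uncolored vertices
-- v of * if v has no outgoing arc or one to an uncolored vertex, +1 if its arc goes to a
-- red vertex and -1 if it goes to a blue one.  Coloring v deletes its term and, since
-- in-degrees are at most one, changes at most the term of the predecessor of v, from * to
-- the mover's ±1; so every Blue option is ⧏ the sum and every Red option ⧐ it.
-- Conversely each player has a best move available: walking backwards through uncolored
-- predecessors of a *-vertex (acyclicity stops the walk) reaches one whose coloring just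
-- deletes a *, and without *-vertices Blue (Red) can color a vertex pointing at red (blue),
-- lowering (raising) the integer part by one.  These conditions are preserved by sums and
-- negation and determine who wins, so the position minus a × * + b − c is a second-player
-- win.

module Submission where

open import Defs
open import Algebra.Bundles using (AbelianGroup; CommutativeMonoid)
open import Algebra.Structures using (IsAbelianGroup)
import Algebra.Properties.AbelianGroup as AbelianGroupProperties
import Algebra.Properties.CommutativeSemigroup as CommutativeSemigroupProperties
open import Data.Bool as Bool using (Bool; true; false; _∧_; _∨_; not)
open import Data.Bool.ListAction using (any; or)
open import Data.Bool.Properties using (T-≡; ¬-not)
open import Data.Empty using (⊥-elim)
open import Data.Fin as Fin using (Fin; zero; suc; splitAt; _↑ˡ_; _↑ʳ_; _≟_; fromℕ<)
import Data.Fin.Properties as Finₚ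
open import Data.Integer as ℤ using (ℤ; +_; 0ℤ; 1ℤ; -1ℤ; -_; pred; _<_; _≤_)
import Data.Integer.Properties as ℤ
open import Data.Integer.Tactic.RingSolver using (solve-∀)
open import Data.List using (List; []; _∷_; allFin; filterᵇ; length; lookup; tabulate)
open import Data.List.Properties using (map-cong; length-filter; length-tabulate)
open import Data.List.Membership.Propositional using (_∈_)
open import Data.List.Membership.Propositional.Properties
  using (∈-allFin; ∈-filter⁺; ∈-filter⁻; ∈-length; ∈-lookup)
import Data.List.Relation.Unary.Any as Any
open import Data.List.Relation.Unary.Any using (here; there)
open import Data.List.Relation.Unary.Any.Properties using (any⁺; any⁻; lookup-index)
open import Data.Nat as ℕ using (ℕ; zero; suc)
import Data.Nat.Properties as ℕₚ
open import Data.Parity.Base as ℙ using (Parity; 0ℙ; 1ℙ; _⁻¹)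
import Data.Parity.Properties as ℙ
open import Data.Product using (Σ; ∃; _×_; _,_; proj₁; proj₂)
open import Data.Sum as Sum using (_⊎_; inj₁; inj₂; [_,_]′)
open import Function using (_∘_)
open import Function.Bundles using (Equivalence)
open import Level using (0ℓ)
open import Relation.Binary using (tri<; tri≈; tri>)
open import Relation.Binary.Construct.Closure.Transitive as Plus using (TransClosure)
open import Relation.Binary.PropositionalEquality
open import Relation.Binary.PropositionalEquality.Algebra using (isMagma)
open import Relation.Nullary using (¬_; yes; no; contradiction)
open import Relation.Nullary.Decidable using (T?)
open ≡-Reasoning

-- Values k + p·*

-- val k p stands for the game k + p·*, with p ∈ ℤ/2.
record Val : Set where
  constructor val
  field
    num : ℤ
    nim : Parity
open Val public

0ᵛ *ᵛ : Val
0ᵛ = val 0ℤ 0ℙ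
*ᵛ = val 0ℤ 1ℙ

infixl 6 _+ᵛ_
infix  8 -ᵛ_

_+ᵛ_ : Val → Val → Val
x +ᵛ y = val (num x ℤ.+ num y) (nim x ℙ.+ nim y)

-ᵛ_ : Val → Val
-ᵛ x = val (- num x) (nim x)

+ᵛ-comm : ∀ x y → x +ᵛ y ≡ y +ᵛ x
+ᵛ-comm x y = cong₂ val (ℤ.+-comm (num x) (num y)) (ℙ.+-comm (nim x) (nim y))

+ᵛ-assoc : ∀ x y z → x +ᵛ y +ᵛ z ≡ x +ᵛ (y +ᵛ z)
+ᵛ-assoc x y z = cong₂ val (ℤ.+-assoc (num x) (num y) (num z)) (ℙ.+-assoc (nim x) (nim y) (nim z))

+ᵛ-identityʳ : ∀ x → x +ᵛ 0ᵛ ≡ x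
+ᵛ-identityʳ x = cong₂ val (ℤ.+-identityʳ (num x)) (ℙ.+-identityʳ (nim x))

+ᵛ-identityˡ : ∀ x → 0ᵛ +ᵛ x ≡ x
+ᵛ-identityˡ x = cong (λ k → val k (nim x)) (ℤ.+-identityˡ (num x))

+ᵛ-inverseˡ : ∀ x → -ᵛ x +ᵛ x ≡ 0ᵛ
+ᵛ-inverseˡ x = cong₂ val (ℤ.+-inverseˡ (num x)) (ℙ.p+p≡0ℙ (nim x))

+ᵛ-inverseʳ : ∀ x → x +ᵛ -ᵛ x ≡ 0ᵛ
+ᵛ-inverseʳ x = cong₂ val (ℤ.+-inverseʳ (num x)) (ℙ.p+p≡0ℙ (nim x))

+ᵛ-isAbelianGroup : IsAbelianGroup _≡_ _+ᵛ_ 0ᵛ -ᵛ_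
+ᵛ-isAbelianGroup = record
  { isGroup = record
    { isMonoid = record
      { isSemigroup = record { isMagma = isMagma _+ᵛ_ ; assoc = +ᵛ-assoc }
      ; identity    = +ᵛ-identityˡ , +ᵛ-identityʳ
      }
    ; inverse = +ᵛ-inverseˡ , +ᵛ-inverseʳ
    ; ⁻¹-cong = cong -ᵛ_
    }
  ; comm = +ᵛ-comm
  }

+ᵛ-abelianGroup : AbelianGroup 0ℓ 0ℓ
+ᵛ-abelianGroup = record { isAbelianGroup = +ᵛ-isAbelianGroup }

open AbelianGroupProperties +ᵛ-abelianGroup using (\\-leftDividesˡ)
open CommutativeSemigroupProperties
  (CommutativeMonoid.commutativeSemigroup (AbelianGroup.commutativeMonoid +ᵛ-abelianGroup))
  using (interchange)

-ᵛ-involutive : ∀ x → -ᵛ -ᵛ x ≡ x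
-ᵛ-involutive x = cong (λ k → val k (nim x)) (ℤ.neg-involutive (num x))

-ᵛ-distrib-+ᵛ : ∀ x y → -ᵛ (x +ᵛ y) ≡ -ᵛ x +ᵛ -ᵛ y
-ᵛ-distrib-+ᵛ x y = cong (λ k → val k (nim x ℙ.+ nim y)) (ℤ.neg-distrib-+ (num x) (num y))

⁻¹-distribˡ-+ : ∀ p q → (p ℙ.+ q) ⁻¹ ≡ p ⁻¹ ℙ.+ q
⁻¹-distribˡ-+ 0ℙ q = refl
⁻¹-distribˡ-+ 1ℙ q = ℙ.⁻¹-involutive q

-- For the games they stand for, x ⧏ y means x ≱ y.
infix 4 _⧏_ _≼_
_⧏_ : Val → Val → Set
x ⧏ y = num x < num y ⊎ (num x ≡ num y × nim y ≡ nim x ⁻¹)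

-- A coarse order, used with integers on the left, where it implies x ≤ y.
_≼_ : Val → Val → Set
x ≼ y = num x < num y ⊎ x ≡ y

⧏-+ᵛ-monoˡ : ∀ {x y} z → x ⧏ y → x +ᵛ z ⧏ y +ᵛ z
⧏-+ᵛ-monoˡ z (inj₁ lt)        = inj₁ (ℤ.+-monoˡ-< (num z) lt)
⧏-+ᵛ-monoˡ {x} z (inj₂ (eq , p)) =
  inj₂ (cong (ℤ._+ num z) eq , trans (cong (ℙ._+ nim z) p) (sym (⁻¹-distribˡ-+ (nim x) (nim z))))

⧏-+ᵛ-monoʳ : ∀ {x y} z → x ⧏ y → z +ᵛ x ⧏ z +ᵛ y
⧏-+ᵛ-monoʳ {x} {y} z x⧏y = subst₂ _⧏_ (+ᵛ-comm x z) (+ᵛ-comm y z) (⧏-+ᵛ-monoˡ z x⧏y)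

≼-+ᵛ-monoˡ : ∀ {x y} z → x ≼ y → x +ᵛ z ≼ y +ᵛ z
≼-+ᵛ-monoˡ z (inj₁ lt)   = inj₁ (ℤ.+-monoˡ-< (num z) lt)
≼-+ᵛ-monoˡ z (inj₂ refl) = inj₂ refl

≼-+ᵛ-monoʳ : ∀ {x y} z → x ≼ y → z +ᵛ x ≼ z +ᵛ y
≼-+ᵛ-monoʳ {x} {y} z x≼y = subst₂ _≼_ (+ᵛ-comm x z) (+ᵛ-comm y z) (≼-+ᵛ-monoˡ z x≼y)

-ᵛ-antimono-⧏ : ∀ {x y} → x ⧏ y → -ᵛ y ⧏ -ᵛ x
-ᵛ-antimono-⧏ (inj₁ lt)        = inj₁ (ℤ.neg-mono-< lt)
-ᵛ-antimono-⧏ {x} {y} (inj₂ (eq , p)) =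
  inj₂ (cong -_ (sym eq) , trans (sym (ℙ.⁻¹-involutive (nim x))) (cong _⁻¹ (sym p)))

-ᵛ-antimono-≼ : ∀ {x y} → x ≼ y → -ᵛ y ≼ -ᵛ x
-ᵛ-antimono-≼ (inj₁ lt)   = inj₁ (ℤ.neg-mono-< lt)
-ᵛ-antimono-≼ (inj₂ refl) = inj₂ refl

<-≼-trans : ∀ {x y z} → num x < num y → y ≼ z → x ≼ z
<-≼-trans x<y (inj₁ y<z) = inj₁ (ℤ.<-trans x<y y<z)
<-≼-trans x<y (inj₂ refl) = inj₁ x<y

≤-⧏-trans : ∀ {x y z} → ¬ y ⧏ x → y ⧏ z → x ⧏ z
≤-⧏-trans y⋪x (inj₁ y<z) = inj₁ (ℤ.≤-<-trans (ℤ.≮⇒≥ (y⋪x ∘ inj₁)) y<z)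
≤-⧏-trans {val a p} {val b q} {val c r} y⋪x (inj₂ (b≡c , r≡q⁻¹)) with ℤ.<-cmp a b
... | tri< a<b _ _ = inj₁ (subst (a <_) b≡c a<b)
... | tri> _ _ b<a = contradiction (inj₁ b<a) y⋪x
... | tri≈ _ refl _ = inj₂ (b≡c , trans r≡q⁻¹ (cong _⁻¹ (sameNim p q λ q≡p⁻¹ → y⋪x (inj₂ (refl , q≡p⁻¹)))))
  where
  sameNim : ∀ p q → ¬ p ≡ q ⁻¹ → q ≡ p
  sameNim 0ℙ 0ℙ _ = refl
  sameNim 1ℙ 1ℙ _ = refl
  sameNim 0ℙ 1ℙ ne = contradiction refl ne
  sameNim 1ℙ 0ℙ ne = contradiction refl ne

nonneg-≼⇒⋪0 : ∀ {k w} → 0ℤ ≤ k → val k 0ℙ ≼ w → ¬ w ⧏ 0ᵛ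
nonneg-≼⇒⋪0 0≤k (inj₁ k<w) (inj₁ w<0)        = ℤ.<-irrefl refl (ℤ.≤-<-trans 0≤k (ℤ.<-trans k<w w<0))
nonneg-≼⇒⋪0 0≤k (inj₁ k<w) (inj₂ (w≡0 , _))  = ℤ.≤⇒≯ 0≤k (subst (_ <_) w≡0 k<w)
nonneg-≼⇒⋪0 0≤k (inj₂ refl) (inj₁ k<0)       = ℤ.≤⇒≯ 0≤k k<0
nonneg-≼⇒⋪0 0≤k (inj₂ refl) (inj₂ (_ , ()))

⧏-irrefl : ∀ {x} → ¬ x ⧏ x
⧏-irrefl (inj₁ x<x)       = ℤ.<-irrefl refl x<x
⧏-irrefl (inj₂ (_ , p≡p⁻¹)) = ℙ.p≢p⁻¹ _ p≡p⁻¹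

≼-+-integer : ∀ {k w} u → nim u ≡ 0ℙ → val k 0ℙ ≼ w → val (k ℤ.+ num u) 0ℙ ≼ w +ᵛ u
≼-+-integer {k} {w} u u∈ℤ k≼w = subst (λ p → val (k ℤ.+ num u) p ≼ w +ᵛ u) u∈ℤ (≼-+ᵛ-monoˡ u k≼w)

+-≼-integer : ∀ {k w} u → nim u ≡ 0ℙ → val k 0ℙ ≼ w → val (num u ℤ.+ k) 0ℙ ≼ u +ᵛ w
+-≼-integer {k} {w} u u∈ℤ k≼w =
  subst (λ p → val (num u ℤ.+ k) p ≼ u +ᵛ w) (trans (ℙ.+-identityʳ (nim u)) u∈ℤ) (≼-+ᵛ-monoʳ u k≼w)

pred<id : ∀ k → pred k < k
pred<id k = ℤ.i≤pred[j]⇒i<j ℤ.≤-refl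

+ᵛ-⧏ : ∀ x {d} → d ⧏ 0ᵛ → x +ᵛ d ⧏ x
+ᵛ-⧏ x d⧏0 = subst (x +ᵛ _ ⧏_) (+ᵛ-identityʳ x) (⧏-+ᵛ-monoʳ x d⧏0)

⧏-+ᵛ : ∀ x {d} → 0ᵛ ⧏ d → x ⧏ x +ᵛ d
⧏-+ᵛ x 0⧏d = subst (_⧏ x +ᵛ _) (+ᵛ-identityʳ x) (⧏-+ᵛ-monoʳ x 0⧏d)

+ᵛ-integer : ∀ {x} k → nim x ≡ 0ℙ → x +ᵛ val k 0ℙ ≡ val (k ℤ.+ num x) 0ℙ
+ᵛ-integer {x} k x∈ℤ = cong₂ val (ℤ.+-comm (num x) k) (trans (ℙ.+-identityʳ (nim x)) x∈ℤ)

+ᵛ*ᵛ-integer : ∀ {x} → nim x ≡ 1ℙ → x +ᵛ *ᵛ ≡ val (num x) 0ℙ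
+ᵛ*ᵛ-integer {x} x∈ℤ+* = cong₂ val (ℤ.+-identityʳ (num x)) (cong (ℙ._+ 1ℙ) x∈ℤ+*)

pred≼+ᵛ*ᵛ : ∀ x → val (pred (num x)) 0ℙ ≼ x +ᵛ *ᵛ
pred≼+ᵛ*ᵛ x = inj₁ (subst (pred (num x) <_) (sym (ℤ.+-identityʳ (num x))) (pred<id (num x)))

+ᵛ*ᵛ≼suc : ∀ x → x +ᵛ *ᵛ ≼ val (ℤ.suc (num x)) 0ℙ
+ᵛ*ᵛ≼suc x = inj₁ (subst (_< ℤ.suc (num x)) (sym (ℤ.+-identityʳ (num x)))
                      (ℤ.i≤pred[j]⇒i<j (ℤ.≤-reflexive (sym (ℤ.pred-suc (num x))))))

-- Certified values of games

SomeOption : ∀ {n} → (Fin n → Val → Set) → (Val → Set) → Set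
SomeOption {n} H P = Σ (Fin n) λ i → Σ Val λ w → H i w × P w

record LeftSide {n} (H : Fin n → Val → Set) (v : Val) : Set where
  constructor leftSide
  field
    below    : ∀ i → Σ Val λ w → H i w × w ⧏ v
    unstar   : nim v ≡ 1ℙ → SomeOption H (val (num v) 0ℙ ≼_)
    decrease : nim v ≡ 0ℙ → 0ℤ < num v → SomeOption H (val (pred (num v)) 0ℙ ≼_)
open LeftSide

-- HasValue G v certifies G = v (see HasValue⇒≈) without developing general game
-- equality.  LeftSide lists Left's obligations; Right's are Left's obligations for -G,
-- phrased through negated option values so that the recursion stays structural.
HasValue : Game → Val → Set
HasValue (mk _ L _ R) v =
  LeftSide (λ i → HasValue (L i)) v × LeftSide (λ j w → HasValue (R j) (-ᵛ w)) (-ᵛ v)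

leftSide-map : ∀ {n} {H H′ : Fin n → Val → Set} {v} →
  (∀ {i w} → H i w → H′ i w) → LeftSide H v → LeftSide H′ v
leftSide-map f (leftSide b u d) = leftSide (λ i → let (w , h , p) = b i in w , f h , p)
  (λ e → let (i , w , h , p) = u e in i , w , f h , p)
  (λ e pos → let (i , w , h , p) = d e pos in i , w , f h , p)

leftSide-negate : ∀ {n} {H : Fin n → Val → Set} {v} →
  (∀ j → Σ Val λ w → H j w × v ⧏ w) →
  (nim v ≡ 1ℙ → SomeOption H (_≼ val (num v) 0ℙ)) →
  (nim v ≡ 0ℙ → num v < 0ℤ → SomeOption H (_≼ val (ℤ.suc (num v)) 0ℙ)) →
  LeftSide (λ j w → H j (-ᵛ w)) (-ᵛ v)
leftSide-negate {H = H} {v} above unstar′ increase = leftSide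
  (λ j → let (w , h , v⧏w) = above j in -ᵛ w , renegate h , -ᵛ-antimono-⧏ v⧏w)
  (λ e → let (j , w , h , w≼k) = unstar′ e in j , -ᵛ w , renegate h , -ᵛ-antimono-≼ w≼k)
  (λ e pos → let (j , w , h , w≼k+1) = increase e (ℤ.neg-cancel-< pos) in
     j , -ᵛ w , renegate h , subst (λ k → val k 0ℙ ≼ -ᵛ w) (ℤ.neg-distrib-+ 1ℤ (num v)) (-ᵛ-antimono-≼ w≼k+1))
  where
  renegate : ∀ {j w} → H j w → H j (-ᵛ -ᵛ w)
  renegate {j} = subst (H j) (sym (-ᵛ-involutive _))

nonnegOption : ∀ {n} {H : Fin n → Val → Set} {v} →
  LeftSide H v → 0ᵛ ⧏ v → SomeOption H (λ w → ¬ w ⧏ 0ᵛ)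
nonnegOption {v = val k 1ℙ} side 0⧏v =
  let (i , w , h , k≼w) = unstar side refl in i , w , h , nonneg-≼⇒⋪0 (0≤k 0⧏v) k≼w
  where
  0≤k : 0ᵛ ⧏ val k 1ℙ → 0ℤ ≤ k
  0≤k (inj₁ 0<k)        = ℤ.<⇒≤ 0<k
  0≤k (inj₂ (refl , _)) = ℤ.≤-refl
nonnegOption {v = val k 0ℙ} side (inj₁ 0<k) =
  let (i , w , h , k-1≼w) = decrease side refl 0<k in i , w , h , nonneg-≼⇒⋪0 (ℤ.i<j⇒i≤pred[j] 0<k) k-1≼w

mutual
  leftWinsFirst⇒0⧏ : ∀ G {v} → HasValue G v → LeftWinsFirst G → 0ᵛ ⧏ v
  leftWinsFirst⇒0⧏ (mk _ L _ R) (ls , _) (i , ¬rwf) =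
    let (w , h , w⧏v) = below ls i in
    ≤-⧏-trans (λ w⧏0 → ¬rwf (⧏0⇒rightWinsFirst (L i) h w⧏0)) w⧏v

  rightWinsFirst⇒⧏0 : ∀ G {v} → HasValue G v → RightWinsFirst G → v ⧏ 0ᵛ
  rightWinsFirst⇒⧏0 (mk _ L _ R) {v} (_ , rs) (j , ¬lwf) =
    let (w , h , w⧏-v) = below rs j in
    subst (_⧏ 0ᵛ) (-ᵛ-involutive v) (-ᵛ-antimono-⧏
      (≤-⧏-trans {x = 0ᵛ} (λ w⧏0 → ¬lwf (0⧏⇒leftWinsFirst (R j) h (-ᵛ-antimono-⧏ w⧏0))) w⧏-v))

  0⧏⇒leftWinsFirst : ∀ G {v} → HasValue G v → 0ᵛ ⧏ v → LeftWinsFirst G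
  0⧏⇒leftWinsFirst (mk _ L _ R) (ls , _) 0⧏v =
    let (i , w , h , w⋪0) = nonnegOption ls 0⧏v in i , w⋪0 ∘ rightWinsFirst⇒⧏0 (L i) h

  ⧏0⇒rightWinsFirst : ∀ G {v} → HasValue G v → v ⧏ 0ᵛ → RightWinsFirst G
  ⧏0⇒rightWinsFirst (mk _ L _ R) (_ , rs) v⧏0 =
    let (j , w , h , w⋪0) = nonnegOption rs (-ᵛ-antimono-⧏ v⧏0) in
    j , λ lwf → w⋪0 (subst (_⧏ 0ᵛ) (-ᵛ-involutive w) (-ᵛ-antimono-⧏ (leftWinsFirst⇒0⧏ (R j) h lwf)))

pick-elim : ∀ {A : Set} {n m} {f : Fin n → A} {g : Fin m → A} (P : A → Set) →
  (∀ a → P (f a)) → (∀ b → P (g b)) → ∀ i → P (pick n m f g i)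
pick-elim {n = n} P pf pg i with splitAt n i
... | inj₁ a = pf a
... | inj₂ b = pg b

pick-↑ˡ : ∀ {A : Set} {n m} (f : Fin n → A) (g : Fin m → A) a → pick n m f g (a ↑ˡ m) ≡ f a
pick-↑ˡ {n = n} {m} f g a = cong [ f , g ]′ (Finₚ.splitAt-↑ˡ n a m)

pick-↑ʳ : ∀ {A : Set} {n m} (f : Fin n → A) (g : Fin m → A) b → pick n m f g (n ↑ʳ b) ≡ g b
pick-↑ʳ {n = n} {m} f g b = cong [ f , g ]′ (Finₚ.splitAt-↑ʳ n m b)

module _ {A : Set} (H : A → Val → Set) {n m} {f : Fin n → A} {g : Fin m → A}
         {H₁ : Fin n → Val → Set} {H₂ : Fin m → Val → Set} {u₁ u₂ : Val}
         (lift₁ : ∀ {a w} → H₁ a w → H (f a) (w +ᵛ u₂))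
         (lift₂ : ∀ {b w} → H₂ b w → H (g b) (u₁ +ᵛ w)) where

  private
    fromFirst : ∀ {P Q} → (∀ {w} → P w → Q (w +ᵛ u₂)) →
      SomeOption H₁ P → SomeOption (λ i → H (pick n m f g i)) Q
    fromFirst P⇒Q (a , w , h , p) =
      a ↑ˡ m , w +ᵛ u₂ , subst (λ G → H G _) (sym (pick-↑ˡ f g a)) (lift₁ h) , P⇒Q p

    fromSecond : ∀ {P Q} → (∀ {w} → P w → Q (u₁ +ᵛ w)) →
      SomeOption H₂ P → SomeOption (λ i → H (pick n m f g i)) Q
    fromSecond P⇒Q (b , w , h , p) =
      n ↑ʳ b , u₁ +ᵛ w , subst (λ G → H G _) (sym (pick-↑ʳ f g b)) (lift₂ h) , P⇒Q p

  leftSide-pick : LeftSide H₁ u₁ → LeftSide H₂ u₂ → LeftSide (λ i → H (pick n m f g i)) (u₁ +ᵛ u₂)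
  leftSide-pick s₁ s₂ = leftSide
    (pick-elim (λ G → Σ Val λ w → H G w × w ⧏ u₁ +ᵛ u₂)
      (λ a → let (w , h , w⧏u₁) = below s₁ a in w +ᵛ u₂ , lift₁ h , ⧏-+ᵛ-monoˡ u₂ w⧏u₁)
      (λ b → let (w , h , w⧏u₂) = below s₂ b in u₁ +ᵛ w , lift₂ h , ⧏-+ᵛ-monoʳ u₁ w⧏u₂))
    (unstarSum (nim u₁) (nim u₂) refl refl)
    (decreaseSum (nim u₁) (nim u₂) refl refl)
    where
    unstarSum : ∀ p q → nim u₁ ≡ p → nim u₂ ≡ q → p ℙ.+ q ≡ 1ℙ →
      SomeOption (λ i → H (pick n m f g i)) (val (num u₁ ℤ.+ num u₂) 0ℙ ≼_)
    unstarSum 1ℙ 0ℙ e₁ e₂ _ = fromFirst (≼-+-integer u₂ e₂) (unstar s₁ e₁)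
    unstarSum 0ℙ 1ℙ e₁ e₂ _ = fromSecond (+-≼-integer u₁ e₁) (unstar s₂ e₂)

    decreaseSum : ∀ p q → nim u₁ ≡ p → nim u₂ ≡ q → p ℙ.+ q ≡ 0ℙ → 0ℤ < num u₁ ℤ.+ num u₂ →
      SomeOption (λ i → H (pick n m f g i)) (val (pred (num u₁ ℤ.+ num u₂)) 0ℙ ≼_)
    decreaseSum 1ℙ 1ℙ e₁ _ _ _ =
      fromFirst (<-≼-trans (pred<id _) ∘ ≼-+ᵛ-monoˡ u₂) (unstar s₁ e₁)
    decreaseSum 0ℙ 0ℙ e₁ e₂ _ pos with 0ℤ ℤ.<? num u₁
    ... | yes 0<k₁ = fromFirst (subst (λ k → val k 0ℙ ≼ _) (ℤ.pred-+ (num u₁) (num u₂)) ∘ ≼-+-integer u₂ e₂)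
                               (decrease s₁ e₁ 0<k₁)
    ... | no 0≮k₁ = fromSecond (subst (λ k → val k 0ℙ ≼ _) (ℤ.+-pred (num u₁) (num u₂)) ∘ +-≼-integer u₁ e₁)
                               (decrease s₂ e₂ (0<k₂ 0≮k₁))
      where
      0<k₂ : ¬ 0ℤ < num u₁ → 0ℤ < num u₂
      0<k₂ 0≮k₁ = ℤ.≰⇒> λ k₂≤0 → ℤ.<⇒≱ pos (ℤ.+-mono-≤ (ℤ.≮⇒≥ 0≮k₁) k₂≤0)

HasValue-⊕ : ∀ X Y {x y} → HasValue X x → HasValue Y y → HasValue (X ⊕ Y) (x +ᵛ y)
HasValue-⊕ X@(mk _ L _ R) Y@(mk _ L′ _ R′) {x} {y} hX@(lX , rX) hY@(lY , rY) =
  leftSide-pick HasValue (λ h → HasValue-⊕ (L _) Y h hY) (λ h → HasValue-⊕ X (L′ _) hX h) lX lY ,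
  subst (LeftSide _) (sym (-ᵛ-distrib-+ᵛ x y))
    (leftSide-pick (λ G w → HasValue G (-ᵛ w))
      (λ {_} {w} h → subst (HasValue _) (-ᵛ-sub-right w y) (HasValue-⊕ (R _) Y h hY))
      (λ {_} {w} h → subst (HasValue _) (-ᵛ-sub-left x w) (HasValue-⊕ X (R′ _) hX h))
      rX rY)
  where
  -ᵛ-sub-right : ∀ w y → -ᵛ w +ᵛ y ≡ -ᵛ (w +ᵛ -ᵛ y)
  -ᵛ-sub-right w y = sym (trans (-ᵛ-distrib-+ᵛ w (-ᵛ y)) (cong (-ᵛ w +ᵛ_) (-ᵛ-involutive y)))
  -ᵛ-sub-left : ∀ x w → x +ᵛ -ᵛ w ≡ -ᵛ (-ᵛ x +ᵛ w)
  -ᵛ-sub-left x w = sym (trans (-ᵛ-distrib-+ᵛ (-ᵛ x) w) (cong (_+ᵛ -ᵛ w) (-ᵛ-involutive x)))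

HasValue-neg : ∀ G {v} → HasValue G v → HasValue (neg G) (-ᵛ v)
HasValue-neg (mk _ L _ R) {v} (l , r) =
  leftSide-map (λ {j} h → subst (HasValue (neg (R j))) (-ᵛ-involutive _) (HasValue-neg (R j) h)) r ,
  subst (LeftSide _) (sym (-ᵛ-involutive v)) (leftSide-map (λ {i} → HasValue-neg (L i)) l)

HasValue⇒≈ : ∀ G H {v} → HasValue G v → HasValue H v → G ≈ H
HasValue⇒≈ G H {v} hG hH =
  (λ lwf → ⧏-irrefl (leftWinsFirst⇒0⧏ (G ⊕ neg H) difference lwf)) ,
  (λ rwf → ⧏-irrefl (rightWinsFirst⇒⧏0 (G ⊕ neg H) difference rwf))
  where
  difference : HasValue (G ⊕ neg H) 0ᵛ
  difference = subst (HasValue _) (+ᵛ-inverseʳ v) (HasValue-⊕ G (neg H) hG (HasValue-neg H hH))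

HasValue-zeroG : HasValue zeroG 0ᵛ
HasValue-zeroG = noOptions , noOptions
  where
  noOptions : ∀ {H : Fin 0 → Val → Set} → LeftSide H 0ᵛ
  noOptions = leftSide (λ ()) (λ ()) (λ _ → λ { (ℤ.+<+ ()) })

HasValue-star : HasValue star *ᵛ
HasValue-star = toZero HasValue-zeroG , toZero HasValue-zeroG
  where
  toZero : ∀ {H : Fin 1 → Val → Set} → (∀ {i} → H i 0ᵛ) → LeftSide H *ᵛ
  toZero h = leftSide (λ _ → 0ᵛ , h , inj₂ (refl , refl)) (λ _ → zero , 0ᵛ , h , inj₂ refl) (λ ())

HasValue-natG : ∀ n → HasValue (natG n) (val (+ n) 0ℙ)
HasValue-natG zero    = HasValue-zeroG
HasValue-natG (suc n) =
  leftSide (λ _ → val (+ n) 0ℙ , HasValue-natG n , inj₁ (ℤ.+<+ (ℕₚ.n<1+n n)))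
           (λ ()) (λ _ _ → zero , val (+ n) 0ℙ , HasValue-natG n , inj₂ refl) ,
  leftSide (λ ()) (λ ()) (λ _ ())

infixr 7 _·ᵛ_
_·ᵛ_ : ℕ → Val → Val
zero  ·ᵛ v = 0ᵛ
suc m ·ᵛ v = v +ᵛ m ·ᵛ v

HasValue-times : ∀ m {G v} → HasValue G v → HasValue (times m G) (m ·ᵛ v)
HasValue-times zero    _  = HasValue-zeroG
HasValue-times (suc m) {G} hG = HasValue-⊕ G (times m G) hG (HasValue-times m hG)

-- Sums over vertices and counts

Σᵛ : ∀ {m} → (Fin m → Val) → Val
Σᵛ {zero}  h = 0ᵛ
Σᵛ {suc m} h = h zero +ᵛ Σᵛ (h ∘ suc)

Σᵛ-cong : ∀ {m} {h g : Fin m → Val} → (∀ i → h i ≡ g i) → Σᵛ h ≡ Σᵛ g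
Σᵛ-cong {zero}  h≗g = refl
Σᵛ-cong {suc m} h≗g = cong₂ _+ᵛ_ (h≗g zero) (Σᵛ-cong (h≗g ∘ suc))

Σᵛ-+ᵛ : ∀ {m} (h g : Fin m → Val) → Σᵛ (λ i → h i +ᵛ g i) ≡ Σᵛ h +ᵛ Σᵛ g
Σᵛ-+ᵛ {zero}  h g = refl
Σᵛ-+ᵛ {suc m} h g = begin
  (h zero +ᵛ g zero) +ᵛ Σᵛ (λ i → h (suc i) +ᵛ g (suc i)) ≡⟨ cong ((h zero +ᵛ g zero) +ᵛ_) (Σᵛ-+ᵛ (h ∘ suc) (g ∘ suc)) ⟩
  (h zero +ᵛ g zero) +ᵛ (Σᵛ (h ∘ suc) +ᵛ Σᵛ (g ∘ suc))   ≡⟨ interchange (h zero) (g zero) (Σᵛ (h ∘ suc)) (Σᵛ (g ∘ suc)) ⟩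
  Σᵛ h +ᵛ Σᵛ g                                            ∎

Σᵛ-difference : ∀ {m} (h h′ : Fin m → Val) → Σᵛ h′ ≡ Σᵛ h +ᵛ Σᵛ (λ i → -ᵛ h i +ᵛ h′ i)
Σᵛ-difference h h′ = begin
  Σᵛ h′                                  ≡⟨ Σᵛ-cong (λ i → sym (\\-leftDividesˡ (h i) (h′ i))) ⟩
  Σᵛ (λ i → h i +ᵛ (-ᵛ h i +ᵛ h′ i))     ≡⟨ Σᵛ-+ᵛ h _ ⟩
  Σᵛ h +ᵛ Σᵛ (λ i → -ᵛ h i +ᵛ h′ i)      ∎

Σᵛ-zero : ∀ m → Σᵛ {m} (λ _ → 0ᵛ) ≡ 0ᵛ
Σᵛ-zero zero    = refl
Σᵛ-zero (suc m) = cong (0ᵛ +ᵛ_) (Σᵛ-zero m)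

Σᵛ-supported₁ : ∀ {m} {d : Fin m → Val} v → (∀ w → w ≢ v → d w ≡ 0ᵛ) → Σᵛ d ≡ d v
Σᵛ-supported₁ {suc m} {d} zero    d≡0 = begin
  d zero +ᵛ Σᵛ (d ∘ suc) ≡⟨ cong (d zero +ᵛ_) (trans (Σᵛ-cong (λ w → d≡0 (suc w) λ ())) (Σᵛ-zero m)) ⟩
  d zero +ᵛ 0ᵛ           ≡⟨ +ᵛ-identityʳ (d zero) ⟩
  d zero                 ∎
Σᵛ-supported₁ {suc m} {d} (suc v) d≡0 = begin
  d zero +ᵛ Σᵛ (d ∘ suc) ≡⟨ cong₂ _+ᵛ_ (d≡0 zero λ ()) (Σᵛ-supported₁ v λ w w≢v → d≡0 (suc w) (w≢v ∘ Finₚ.suc-injective)) ⟩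
  0ᵛ +ᵛ d (suc v)        ≡⟨ +ᵛ-identityˡ (d (suc v)) ⟩
  d (suc v)              ∎

Σᵛ-supported₂ : ∀ {m} {d : Fin m → Val} u v → u ≢ v → (∀ w → w ≢ u → w ≢ v → d w ≡ 0ᵛ) →
  Σᵛ d ≡ d u +ᵛ d v
Σᵛ-supported₂ zero zero u≢v _ = contradiction refl u≢v
Σᵛ-supported₂ {d = d} zero (suc v) _ d≡0 =
  cong (d zero +ᵛ_) (Σᵛ-supported₁ v λ w w≢v → d≡0 (suc w) (λ ()) (w≢v ∘ Finₚ.suc-injective))
Σᵛ-supported₂ {d = d} (suc u) zero _ d≡0 = begin
  d zero +ᵛ Σᵛ (d ∘ suc) ≡⟨ cong (d zero +ᵛ_) (Σᵛ-supported₁ u λ w w≢u → d≡0 (suc w) (w≢u ∘ Finₚ.suc-injective) (λ ())) ⟩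
  d zero +ᵛ d (suc u)    ≡⟨ +ᵛ-comm (d zero) (d (suc u)) ⟩
  d (suc u) +ᵛ d zero    ∎
Σᵛ-supported₂ {d = d} (suc u) (suc v) u≢v d≡0 = begin
  d zero +ᵛ Σᵛ (d ∘ suc)        ≡⟨ cong₂ _+ᵛ_ (d≡0 zero (λ ()) (λ ()))
                                     (Σᵛ-supported₂ u v (u≢v ∘ cong suc) λ w w≢u w≢v →
                                        d≡0 (suc w) (w≢u ∘ Finₚ.suc-injective) (w≢v ∘ Finₚ.suc-injective)) ⟩
  0ᵛ +ᵛ (d (suc u) +ᵛ d (suc v)) ≡⟨ +ᵛ-identityˡ _ ⟩
  d (suc u) +ᵛ d (suc v)        ∎

χ : Bool → ℕ
χ true  = 1
χ false = 0

count : ∀ {X : Set} → (X → Bool) → List X → ℕ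
count p xs = length (filterᵇ p xs)

count-∷ : ∀ {X : Set} (p : X → Bool) x xs → count p (x ∷ xs) ≡ χ (p x) ℕ.+ count p xs
count-∷ p x xs with p x
... | true  = refl
... | false = refl

countValue : (a b c : ℕ) → Val
countValue a b c = val (+ b ℤ.- + c) (ℕ.parity a)

countValue-+ : ∀ a b c a′ b′ c′ →
  countValue a b c +ᵛ countValue a′ b′ c′ ≡ countValue (a ℕ.+ a′) (b ℕ.+ b′) (c ℕ.+ c′)
countValue-+ a b c a′ b′ c′ =
  cong₂ val (regroup (+ b) (+ c) (+ b′) (+ c′)) (sym (ℙ.+-homo-+ a a′))
  where
  regroup : ∀ i j k l → (i ℤ.- j) ℤ.+ (k ℤ.- l) ≡ (i ℤ.+ k) ℤ.- (j ℤ.+ l)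
  regroup = solve-∀

Σᵛ-countValue : ∀ {X : Set} m (g : Fin m → X) (a b c : X → Bool) →
  Σᵛ (λ i → countValue (χ (a (g i))) (χ (b (g i))) (χ (c (g i)))) ≡
  countValue (count a (tabulate g)) (count b (tabulate g)) (count c (tabulate g))
Σᵛ-countValue zero    g a b c = refl
Σᵛ-countValue (suc m) g a b c = begin
  countValue (χ (a x)) (χ (b x)) (χ (c x)) +ᵛ Σᵛ (λ i → countValue (χ (a (g (suc i)))) (χ (b (g (suc i)))) (χ (c (g (suc i)))))
    ≡⟨ cong (countValue (χ (a x)) (χ (b x)) (χ (c x)) +ᵛ_) (Σᵛ-countValue m (g ∘ suc) a b c) ⟩
  countValue (χ (a x)) (χ (b x)) (χ (c x)) +ᵛ countValue (count a xs) (count b xs) (count c xs)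
    ≡⟨ countValue-+ (χ (a x)) (χ (b x)) (χ (c x)) (count a xs) (count b xs) (count c xs) ⟩
  countValue (χ (a x) ℕ.+ count a xs) (χ (b x) ℕ.+ count b xs) (χ (c x) ℕ.+ count c xs)
    ≡⟨ sym (cong₃ countValue (count-∷ a x xs) (count-∷ b x xs) (count-∷ c x xs)) ⟩
  countValue (count a (x ∷ xs)) (count b (x ∷ xs)) (count c (x ∷ xs))
    ∎
  where
  x = g zero
  xs = tabulate (g ∘ suc)
  cong₃ : ∀ {A B C D : Set} (f : A → B → C → D) {a a′ b b′ c c′} → a ≡ a′ → b ≡ b′ → c ≡ c′ → f a b c ≡ f a′ b′ c′
  cong₃ f refl refl refl = refl

χ-mono : ∀ {a b} → (a ≡ true → b ≡ true) → χ a ℕ.≤ χ b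
χ-mono {false} _   = ℕ.z≤n
χ-mono {true}  a⇒b rewrite a⇒b refl = ℕₚ.≤-refl

module _ {X : Set} {p q : X → Bool} (p⇒q : ∀ x → p x ≡ true → q x ≡ true) where

  count-mono : ∀ xs → count p xs ℕ.≤ count q xs
  count-mono []       = ℕ.z≤n
  count-mono (x ∷ xs) rewrite count-∷ p x xs | count-∷ q x xs =
    ℕₚ.+-mono-≤ (χ-mono (p⇒q x)) (count-mono xs)

  count-mono-< : ∀ {x xs} → x ∈ xs → p x ≡ false → q x ≡ true → count p xs ℕ.< count q xs
  count-mono-< {xs = x ∷ xs} (here refl) px qx rewrite count-∷ p x xs | count-∷ q x xs | px | qx =
    ℕ.s≤s (count-mono xs)
  count-mono-< {xs = y ∷ xs} (there x∈xs) px qx rewrite count-∷ p y xs | count-∷ q y xs =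
    ℕₚ.+-mono-≤-< (χ-mono (p⇒q y)) (count-mono-< x∈xs px qx)

count-witness : ∀ {X : Set} (p : X → Bool) xs → 0 ℕ.< count p xs → Σ X λ x → p x ≡ true
count-witness p xs pos =
  let (_ , px) = ∈-filter⁻ (T? ∘ p) {xs = xs} (∈-lookup {xs = filterᵇ p xs} (fromℕ< pos)) in _ , Equivalence.to T-≡ px

·ᵛ-*ᵛ : ∀ m → m ·ᵛ *ᵛ ≡ val 0ℤ (ℕ.parity m)
·ᵛ-*ᵛ zero    = refl
·ᵛ-*ᵛ (suc m) = cong₂ val (cong (λ k → 0ℤ ℤ.+ k) (cong num (·ᵛ-*ᵛ m)))
                          (trans (cong (1ℙ ℙ.+_) (cong nim (·ᵛ-*ᵛ m))) (ℙ.suc-homo-⁻¹ (suc m)))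

formula-countValue : ∀ a b c → a ·ᵛ *ᵛ +ᵛ val (+ b) 0ℙ +ᵛ -ᵛ val (+ c) 0ℙ ≡ countValue a b c
formula-countValue a b c rewrite ·ᵛ-*ᵛ a =
  cong (val (+ b ℤ.- + c)) (trans (ℙ.+-identityʳ _) (ℙ.+-identityʳ (ℕ.parity a)))

-- Myopic Col

==⇒≡ : ∀ {x y} → (x == y) ≡ true → x ≡ y
==⇒≡ {uncolored} {uncolored} _ = refl
==⇒≡ {red}       {red}       _ = refl
==⇒≡ {blue}      {blue}      _ = refl
==⇒≡ {uncolored} {red}  ()
==⇒≡ {uncolored} {blue} ()
==⇒≡ {red}  {uncolored} ()
==⇒≡ {red}  {blue}      ()
==⇒≡ {blue} {uncolored} ()
==⇒≡ {blue} {red}       ()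

≢⇒==false : ∀ {x y} → x ≢ y → (x == y) ≡ false
≢⇒==false x≢y = ¬-not (x≢y ∘ ==⇒≡)

any-true : ∀ {A : Set} (f : A → Bool) {x xs} → x ∈ xs → f x ≡ true → any f xs ≡ true
any-true f x∈xs fx = Equivalence.to T-≡ (any⁺ f (Any.map (λ { refl → Equivalence.from T-≡ fx }) x∈xs))

any-witness : ∀ {A : Set} (f : A → Bool) xs → any f xs ≡ true → ∃ λ x → f x ≡ true
any-witness f xs e =
  let (x , fx) = Any.satisfied (any⁻ f xs (Equivalence.from T-≡ e)) in x , Equivalence.to T-≡ fx

any-false : ∀ {A : Set} (f : A → Bool) xs → (∀ x → f x ≡ false) → any f xs ≡ false
any-false f xs none = ¬-not λ e → let (x , fx) = any-witness f xs e in contradiction (trans (sym fx) (none x)) λ ()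

∧-true : ∀ {a b} → a ∧ b ≡ true → a ≡ true × b ≡ true
∧-true {true} b = refl , b

find : ∀ {n} (f : Fin n → Bool) → (∃ λ i → f i ≡ true) ⊎ (∀ i → f i ≡ false)
find f with Finₚ.any? (λ i → f i Bool.≟ true)
... | yes found = inj₁ found
... | no  none  = inj₂ λ i → ¬-not λ fi → none (i , fi)

uncolored? : ∀ x → x ≡ uncolored ⊎ x ≢ uncolored
uncolored? uncolored = inj₁ refl
uncolored? red       = inj₂ λ ()
uncolored? blue      = inj₂ λ ()

colorValue : Color → Val
colorValue uncolored = *ᵛ
colorValue red       = val 1ℤ 0ℙ
colorValue blue      = val -1ℤ 0ℙ

opponent : Color → Color
opponent uncolored = uncolored
opponent red       = blue
opponent blue      = red

-- The arc out of a vertex where A may move does not end at color A.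
colorValue-allowed : ∀ x A → A ≢ uncolored → (x == A) ≡ false →
  colorValue x ≡ *ᵛ ⊎ colorValue x ≡ colorValue (opponent A)
colorValue-allowed uncolored _         _   _  = inj₁ refl
colorValue-allowed red       blue      _   _  = inj₂ refl
colorValue-allowed blue      red       _   _  = inj₂ refl
colorValue-allowed red       red       _   ()
colorValue-allowed blue      blue      _   ()
colorValue-allowed _         uncolored A≢u _  = contradiction refl A≢u

-- A Blue move lowers the value, a Red move raises it: the moved vertex pointed at an
-- uncolored or opponent vertex, and the predecessor can only gain the mover's color.
blueMove-⧏0 : ∀ {σ π} → σ ≡ *ᵛ ⊎ σ ≡ colorValue red → π ≡ 0ᵛ ⊎ π ≡ -ᵛ *ᵛ +ᵛ colorValue blue →
  -ᵛ σ +ᵛ π ⧏ 0ᵛ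
blueMove-⧏0 (inj₁ refl) (inj₁ refl) = inj₂ (refl , refl)
blueMove-⧏0 (inj₁ refl) (inj₂ refl) = inj₁ ℤ.-<+
blueMove-⧏0 (inj₂ refl) (inj₁ refl) = inj₁ ℤ.-<+
blueMove-⧏0 (inj₂ refl) (inj₂ refl) = inj₁ ℤ.-<+

redMove-0⧏ : ∀ {σ π} → σ ≡ *ᵛ ⊎ σ ≡ colorValue blue → π ≡ 0ᵛ ⊎ π ≡ -ᵛ *ᵛ +ᵛ colorValue red →
  0ᵛ ⧏ -ᵛ σ +ᵛ π
redMove-0⧏ (inj₁ refl) (inj₁ refl) = inj₂ (refl , refl)
redMove-0⧏ (inj₁ refl) (inj₂ refl) = inj₁ (ℤ.+<+ ℕ.z<s)
redMove-0⧏ (inj₂ refl) (inj₁ refl) = inj₁ (ℤ.+<+ ℕ.z<s)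
redMove-0⧏ (inj₂ refl) (inj₂ refl) = inj₁ (ℤ.+<+ ℕ.z<s)

recolor-same : ∀ {n} (c : Fin n → Color) v A → recolor c v A v ≡ A
recolor-same c v A with v ≟ v
... | yes _   = refl
... | no  v≢v = contradiction refl v≢v

recolor-other : ∀ {n} (c : Fin n → Color) {v w} A → w ≢ v → recolor c v A w ≡ c w
recolor-other c {v} {w} A w≢v with w ≟ v
... | yes w≡v = contradiction w≡v w≢v
... | no  _   = refl

module _ {n : ℕ} (E : Digraph n) where

  OutUnique : Set
  OutUnique = ∀ v w w′ → Arc E v w → Arc E v w′ → w ≡ w′

  hasOutArc-arc : ∀ {v w} → Arc E v w → hasOutArc E v ≡ true
  hasOutArc-arc {w = w} = any-true _ (∈-allFin w)

  hasOutArc-none : ∀ {v} → (∀ w → E v w ≡ false) → hasOutArc E v ≡ false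
  hasOutArc-none = any-false _ (allFin n)

  hasArcTo-none : ∀ {v} c X → (∀ w → E v w ≡ false) → hasArcTo E c X v ≡ false
  hasArcTo-none {v} c X none = any-false _ (allFin n) λ w → cong (_∧ (c w == X)) (none w)

  hasArcTo-arc : OutUnique → ∀ {v w} c X → Arc E v w → hasArcTo E c X v ≡ (c w == X)
  hasArcTo-arc outUnique {v} {w} c X arc with c w == X in cw
  ... | true  = any-true _ (∈-allFin w) (cong₂ _∧_ arc cw)
  ... | false = any-false _ (allFin n) onlyW
    where
    onlyW : ∀ w′ → (E v w′ ∧ (c w′ == X)) ≡ false
    onlyW w′ with E v w′ in arc′
    ... | true  = subst (λ u → (c u == X) ≡ false) (outUnique v w w′ arc arc′) cw
    ... | false = refl

  hasArcTo-local : ∀ {c c′ v} X → (∀ w → Arc E v w → c′ w ≡ c w) → hasArcTo E c′ X v ≡ hasArcTo E c X v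
  hasArcTo-local {c} {c′} {v} X agree = cong or (map-cong pointwise (allFin n))
    where
    pointwise : ∀ w → (E v w ∧ (c′ w == X)) ≡ (E v w ∧ (c w == X))
    pointwise w with E v w in arc
    ... | true  = cong (_== X) (agree w arc)
    ... | false = refl

  isA isB isC : (Fin n → Color) → Fin n → Bool
  isA c v = (c v == uncolored) ∧ (not (hasOutArc E v) ∨ hasArcTo E c uncolored v)
  isB c v = (c v == uncolored) ∧ hasArcTo E c red v
  isC c v = (c v == uncolored) ∧ hasArcTo E c blue v

  contribution : (Fin n → Color) → Fin n → Val
  contribution c v = countValue (χ (isA c v)) (χ (isB c v)) (χ (isC c v))

  value : (Fin n → Color) → Val
  value c = Σᵛ (contribution c)

  value≡countValue : ∀ c → value c ≡ countValue (countA E c) (countB E c) (countC E c)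
  value≡countValue c = Σᵛ-countValue n (λ i → i) (isA c) (isB c) (isC c)

  contribution-colored : ∀ c {v} → c v ≢ uncolored → contribution c v ≡ 0ᵛ
  contribution-colored c cv≢u rewrite ≢⇒==false cv≢u = refl

  contribution-end : ∀ c {v} → c v ≡ uncolored → (∀ w → E v w ≡ false) → contribution c v ≡ *ᵛ
  contribution-end c cv end
    rewrite cv | hasOutArc-none end | hasArcTo-none c red end | hasArcTo-none c blue end = refl

  contribution-arc : OutUnique → ∀ c {v w} → c v ≡ uncolored → Arc E v w →
    contribution c v ≡ colorValue (c w)
  contribution-arc outUnique c {w = w} cv arc
    rewrite cv | hasOutArc-arc arc | hasArcTo-arc outUnique c uncolored arc
          | hasArcTo-arc outUnique c red arc | hasArcTo-arc outUnique c blue arc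
    with c w
  ... | uncolored = refl
  ... | red       = refl
  ... | blue      = refl

  contribution-local : ∀ {c c′ v} → c′ v ≡ c v → (∀ w → Arc E v w → c′ w ≡ c w) →
    contribution c′ v ≡ contribution c v
  contribution-local c′v agree
    rewrite c′v | hasArcTo-local uncolored agree | hasArcTo-local red agree | hasArcTo-local blue agree = refl

  hasArcTo-witness : ∀ c {v} X → hasArcTo E c X v ≡ true → ∃ λ w → Arc E v w × c w ≡ X
  hasArcTo-witness c X h =
    let (w , e) = any-witness _ (allFin n) h ; (arc , cw) = ∧-true e in w , arc , ==⇒≡ cw

  legal⇒ : ∀ {c A v} → legal E c A v ≡ true → c v ≡ uncolored × hasArcTo E c A v ≡ false
  legal⇒ {c} {A} {v} lg with c v == uncolored in cv | hasArcTo E c A v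
  ... | true  | false = ==⇒≡ cv , refl
  ... | true  | true  = contradiction lg λ ()
  ... | false | _     = contradiction lg λ ()

  legal⇐ : ∀ {c A v} → c v ≡ uncolored → hasArcTo E c A v ≡ false → legal E c A v ≡ true
  legal⇐ cv noArc = cong₂ (λ u a → u ∧ not a) (cong (_== uncolored) cv) noArc

  uncoloredCount : (Fin n → Color) → ℕ
  uncoloredCount c = countV (λ v → c v == uncolored)

  uncoloredCount≤n : ∀ c → uncoloredCount c ℕ.≤ n
  uncoloredCount≤n c = ℕₚ.≤-trans (length-filter _ (allFin n)) (ℕₚ.≤-reflexive (length-tabulate (λ v → v)))

  recolor-decreases : ∀ c {v} A → c v ≡ uncolored → A ≢ uncolored →
    uncoloredCount (recolor c v A) ℕ.< uncoloredCount c
  recolor-decreases c {v} A cv A≢u =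
    count-mono-< stillUncolored (∈-allFin v) (trans (cong (_== uncolored) (recolor-same c v A)) (≢⇒==false A≢u))
                 (cong (_== uncolored) cv)
    where
    stillUncolored : ∀ w → (recolor c v A w == uncolored) ≡ true → (c w == uncolored) ≡ true
    stillUncolored w e with w ≟ v
    ... | yes refl = contradiction (==⇒≡ e) A≢u
    ... | no  _    = e

  value-allColored : ∀ c → uncoloredCount c ℕ.≤ 0 → value c ≡ 0ᵛ
  value-allColored c none = trans (Σᵛ-cong λ v → contribution-colored c (colored v)) (Σᵛ-zero n)
    where
    colored : ∀ v → c v ≢ uncolored
    colored v cv = ℕₚ.<⇒≱ (∈-length (∈-filter⁺ (T? ∘ (λ w → c w == uncolored)) (∈-allFin v)
                                                 (Equivalence.from T-≡ (cong (_== uncolored) cv)))) none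

  data Chain : ℕ → Fin n → Fin n → Set where
    []  : ∀ {w} → Chain 0 w w
    _∷_ : ∀ {m x y w} → Arc E x y → Chain m y w → Chain (suc m) x w

  vertexAt : ∀ {m x w} → Chain m x w → Fin (suc m) → Fin n
  vertexAt {x = x} _        zero    = x
  vertexAt         (_ ∷ ch) (suc i) = vertexAt ch i

  chain-reaches : ∀ {m x w} (ch : Chain m x w) {i j} → i Fin.< j →
    TransClosure (Arc E) (vertexAt ch i) (vertexAt ch j)
  chain-reaches (arc ∷ ch) {zero}  {suc j} _           = fromHead arc ch j
    where
    fromHead : ∀ {m x y w} → Arc E x y → (ch : Chain m y w) → ∀ j → TransClosure (Arc E) x (vertexAt ch j)
    fromHead arc ch          zero    = Plus.[ arc ]
    fromHead arc (arc′ ∷ ch) (suc j) = arc Plus.∷ fromHead arc′ ch j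
  chain-reaches (_ ∷ ch)   {suc i} {suc j} (ℕ.s≤s i<j) = chain-reaches ch i<j

  Acyclic : Set
  Acyclic = ∀ v → ¬ TransClosure (Arc E) v v

  -- A chain with n arcs visits n + 1 vertices, so one of them repeats.
  noLongChain : Acyclic → ∀ {x w} → ¬ Chain n x w
  noLongChain acyclic ch with Finₚ.pigeonhole (ℕₚ.n<1+n n) (vertexAt ch)
  ... | i , j , i<j , same =
    acyclic _ (subst (λ v → TransClosure (Arc E) v (vertexAt ch j)) same (chain-reaches ch i<j))

  module OnPaths (paths : IsDisjointUnionOfPaths E) where

    private
      outUnique : OutUnique
      outUnique = proj₁ paths

      inUnique : ∀ v v′ w → Arc E v w → Arc E v′ w → v ≡ v′
      inUnique = proj₁ (proj₂ paths)

      acyclic : Acyclic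
      acyclic = proj₂ (proj₂ paths)

    noLoop : ∀ {u v} → Arc E u v → u ≢ v
    noLoop arc refl = acyclic _ Plus.[ arc ]

    NoUncoloredPredecessor : (Fin n → Color) → Fin n → Set
    NoUncoloredPredecessor c v = ∀ u → Arc E u v → c u ≢ uncolored

    module _ (c : Fin n → Color) {v : Fin n} (A : Color) (cv : c v ≡ uncolored) (A≢u : A ≢ uncolored) where

      private
        c′ : Fin n → Color
        c′ = recolor c v A

        δ : Fin n → Val
        δ w = -ᵛ contribution c w +ᵛ contribution c′ w

        δ-here : δ v ≡ -ᵛ contribution c v
        δ-here = trans (cong (-ᵛ contribution c v +ᵛ_)
                             (contribution-colored c′ (A≢u ∘ trans (sym (recolor-same c v A)))))
                       (+ᵛ-identityʳ (-ᵛ contribution c v))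

        δ-unaffected : ∀ {w} → w ≢ v → E w v ≡ false → δ w ≡ 0ᵛ
        δ-unaffected {w} w≢v noArc =
          trans (cong (-ᵛ contribution c w +ᵛ_) (contribution-local (recolor-other c A w≢v) successorKept))
                (+ᵛ-inverseˡ (contribution c w))
          where
          successorKept : ∀ s → Arc E w s → c′ s ≡ c s
          successorKept s arc = recolor-other c A λ { refl → contradiction (trans (sym arc) noArc) λ () }

        δ-predecessor : ∀ {u} → Arc E u v → c u ≡ uncolored → δ u ≡ -ᵛ *ᵛ +ᵛ colorValue A
        δ-predecessor arc cu = cong₂ (λ σ τ → -ᵛ σ +ᵛ τ)
          (trans (contribution-arc outUnique c cu arc) (cong colorValue cv))
          (trans (contribution-arc outUnique c′ (trans (recolor-other c A (noLoop arc)) cu) arc)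
                 (cong colorValue (recolor-same c v A)))

        δ-coloredPredecessor : ∀ {u} → c u ≢ uncolored → δ u ≡ 0ᵛ
        δ-coloredPredecessor {u} cu≢u = cong₂ (λ σ τ → -ᵛ σ +ᵛ τ)
          (contribution-colored c cu≢u)
          (contribution-colored c′ (cu≢u ∘ trans (sym (recolor-other c A (cu≢u ∘ λ { refl → cv })))))

      -- Coloring v removes its contribution and changes at most that of its predecessor.
      recolor-value : Σ Val λ π → value (recolor c v A) ≡ value c +ᵛ (-ᵛ contribution c v +ᵛ π)
                                × (π ≡ 0ᵛ ⊎ π ≡ -ᵛ *ᵛ +ᵛ colorValue A)
                                × (NoUncoloredPredecessor c v → π ≡ 0ᵛ)
      recolor-value with find (λ u → E u v)
      ... | inj₂ noPredecessor = 0ᵛ , change , inj₁ refl , λ _ → refl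
        where
        change : value c′ ≡ value c +ᵛ (-ᵛ contribution c v +ᵛ 0ᵛ)
        change = begin
          value c′                                ≡⟨ Σᵛ-difference (contribution c) (contribution c′) ⟩
          value c +ᵛ Σᵛ δ                         ≡⟨ cong (value c +ᵛ_) (Σᵛ-supported₁ v λ w w≢v → δ-unaffected w≢v (noPredecessor w)) ⟩
          value c +ᵛ δ v                          ≡⟨ cong (value c +ᵛ_) (trans δ-here (sym (+ᵛ-identityʳ (-ᵛ contribution c v)))) ⟩
          value c +ᵛ (-ᵛ contribution c v +ᵛ 0ᵛ)  ∎
      ... | inj₁ (u , arc) = δ u , change , predecessorCases (uncolored? (c u)) , λ noUP → δ-coloredPredecessor (noUP u arc)
        where
        change : value c′ ≡ value c +ᵛ (-ᵛ contribution c v +ᵛ δ u)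
        change = begin
          value c′                                ≡⟨ Σᵛ-difference (contribution c) (contribution c′) ⟩
          value c +ᵛ Σᵛ δ                         ≡⟨ cong (value c +ᵛ_) (Σᵛ-supported₂ v u (noLoop arc ∘ sym) λ w w≢v w≢u →
                                                       δ-unaffected w≢v (¬-not λ arc′ → w≢u (inUnique w u v arc′ arc))) ⟩
          value c +ᵛ (δ v +ᵛ δ u)                 ≡⟨ cong (λ d → value c +ᵛ (d +ᵛ δ u)) δ-here ⟩
          value c +ᵛ (-ᵛ contribution c v +ᵛ δ u) ∎
        predecessorCases : c u ≡ uncolored ⊎ c u ≢ uncolored → δ u ≡ 0ᵛ ⊎ δ u ≡ -ᵛ *ᵛ +ᵛ colorValue A
        predecessorCases (inj₁ cu)    = inj₂ (δ-predecessor arc cu)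
        predecessorCases (inj₂ cu≢u) = inj₁ (δ-coloredPredecessor cu≢u)

    legal-contribution : ∀ {c A v} → A ≢ uncolored → legal E c A v ≡ true →
      contribution c v ≡ *ᵛ ⊎ contribution c v ≡ colorValue (opponent A)
    legal-contribution {c} {A} {v} A≢u lg with find (E v)
    ... | inj₂ end       = inj₁ (contribution-end c (proj₁ (legal⇒ lg)) end)
    ... | inj₁ (w , arc) = Sum.map (trans σ≡) (trans σ≡) (colorValue-allowed (c w) A A≢u w≢A)
      where
      σ≡ : contribution c v ≡ colorValue (c w)
      σ≡ = contribution-arc outUnique c (proj₁ (legal⇒ lg)) arc
      w≢A : (c w == A) ≡ false
      w≢A = trans (sym (hasArcTo-arc outUnique c A arc)) (proj₂ (legal⇒ lg))

    isA⇒uncolored : ∀ {c x} → isA c x ≡ true → c x ≡ uncolored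
    isA⇒uncolored = ==⇒≡ ∘ proj₁ ∘ ∧-true

    isA⇒successorUncolored : ∀ {c x s} → isA c x ≡ true → Arc E x s → c s ≡ uncolored
    isA⇒successorUncolored {c} ax arc
      rewrite hasOutArc-arc arc | hasArcTo-arc outUnique c uncolored arc = ==⇒≡ (proj₂ (∧-true ax))

    predecessor-isA : ∀ {c u x} → Arc E u x → c u ≡ uncolored → c x ≡ uncolored → isA c u ≡ true
    predecessor-isA {c} arc cu cx
      rewrite cu | hasOutArc-arc arc | hasArcTo-arc outUnique c uncolored arc | cx = refl

    isA-contribution : ∀ {c x} → isA c x ≡ true → contribution c x ≡ *ᵛ
    isA-contribution {c} {x} ax with find (E x)
    ... | inj₂ end       = contribution-end c (isA⇒uncolored ax) end
    ... | inj₁ (s , arc) = trans (contribution-arc outUnique c (isA⇒uncolored ax) arc)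
                                 (cong colorValue (isA⇒successorUncolored ax arc))

    isA-legal : ∀ {c x} A → A ≢ uncolored → isA c x ≡ true → legal E c A x ≡ true
    isA-legal {c} {x} A A≢u ax = legal⇐ (isA⇒uncolored ax) noArcToA
      where
      noArcToA : hasArcTo E c A x ≡ false
      noArcToA with find (E x)
      ... | inj₂ end       = hasArcTo-none c A end
      ... | inj₁ (s , arc) = trans (hasArcTo-arc outUnique c A arc)
                                   (trans (cong (_== A) (isA⇒successorUncolored ax arc)) (≢⇒==false (A≢u ∘ sym)))

    TopA : (Fin n → Color) → Set
    TopA c = Σ (Fin n) λ x → isA c x ≡ true × NoUncoloredPredecessor c x

    -- Uncolored predecessors of a-vertices are a-vertices, so walk backwards along them.
    walkBack : ∀ c m {w} → isA c w ≡ true → TopA c ⊎ Σ (Fin n) λ x → isA c x ≡ true × Chain m x w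
    walkBack c zero    aw = inj₂ (_ , aw , [])
    walkBack c (suc m) aw with walkBack c m aw
    ... | inj₁ top          = inj₁ top
    ... | inj₂ (x , ax , ch) with find (λ u → E u x ∧ (c u == uncolored))
    ...   | inj₁ (u , e) = let (arc , cu) = ∧-true e in
                           inj₂ (u , predecessor-isA arc (==⇒≡ cu) (isA⇒uncolored ax) , arc ∷ ch)
    ...   | inj₂ none    = inj₁ (x , ax , λ u arc cu →
                             contradiction (trans (sym (cong₂ _∧_ arc (cong (_== uncolored) cu))) (none u)) λ ())

    topA : ∀ c {w} → isA c w ≡ true → TopA c
    topA c aw with walkBack c n aw
    ... | inj₁ top          = top
    ... | inj₂ (_ , _ , ch) = ⊥-elim (noLongChain acyclic ch)

    topA-move : ∀ c A → A ≢ uncolored → ((x , _) : TopA c) →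
      legal E c A x ≡ true × value (recolor c x A) ≡ value c +ᵛ *ᵛ
    topA-move c A A≢u (x , ax , top) =
      let (π , change , _ , π≡0) = recolor-value c A (isA⇒uncolored ax) A≢u in
      isA-legal A A≢u ax ,
      trans change (cong₂ (λ σ π → value c +ᵛ (-ᵛ σ +ᵛ π)) (isA-contribution ax) (π≡0 top))

    arc-move : ∀ c A {w s} → A ≢ uncolored → (∀ u → isA c u ≡ false) →
      c w ≡ uncolored → Arc E w s → c s ≡ opponent A →
      legal E c A w ≡ true × value (recolor c w A) ≡ value c +ᵛ -ᵛ colorValue (opponent A)
    arc-move c A {w} {s} A≢u noA cw arc cs =
      let (π , change , _ , π≡0) = recolor-value c A cw A≢u in
      legal⇐ cw (trans (hasArcTo-arc outUnique c A arc) (trans (cong (_== A) cs) (opponent≢ A A≢u))) ,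
      (begin
        value (recolor c w A)                            ≡⟨ change ⟩
        value c +ᵛ (-ᵛ contribution c w +ᵛ π)            ≡⟨ cong₂ (λ σ π → value c +ᵛ (-ᵛ σ +ᵛ π)) σ≡ (π≡0 noUP) ⟩
        value c +ᵛ (-ᵛ colorValue (opponent A) +ᵛ 0ᵛ)   ≡⟨ cong (value c +ᵛ_) (+ᵛ-identityʳ _) ⟩
        value c +ᵛ -ᵛ colorValue (opponent A)           ∎)
      where
      σ≡ : contribution c w ≡ colorValue (opponent A)
      σ≡ = trans (contribution-arc outUnique c cw arc) (cong colorValue cs)
      noUP : NoUncoloredPredecessor c w
      noUP u arc′ cu = contradiction (trans (sym (predecessor-isA arc′ cu cw)) (noA u)) λ ()
      opponent≢ : ∀ A → A ≢ uncolored → (opponent A == A) ≡ false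
      opponent≢ uncolored A≢u = contradiction refl A≢u
      opponent≢ red       _   = refl
      opponent≢ blue      _   = refl

    someA : ∀ c → nim (value c) ≡ 1ℙ → ∃ λ x → isA c x ≡ true
    someA c odd = count-witness (isA c) (allFin n) (nonzero (countA E c) (trans (sym (cong nim (value≡countValue c))) odd))
      where
      nonzero : ∀ a → ℕ.parity a ≡ 1ℙ → 0 ℕ.< a
      nonzero (suc a) _ = ℕ.z<s

    someB : ∀ c → 0ℤ ℤ.< num (value c) → ∃ λ x → isB c x ≡ true
    someB c pos = count-witness (isB c) (allFin n) (positive (countB E c) (countC E c) (subst (0ℤ ℤ.<_) (cong num (value≡countValue c)) pos))
      where
      positive : ∀ b c → 0ℤ ℤ.< + b ℤ.- + c → 0 ℕ.< b
      positive zero zero    (ℤ.+<+ ())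
      positive zero (suc c) ()
      positive (suc b) _    _ = ℕ.z<s

    someC : ∀ c → num (value c) ℤ.< 0ℤ → ∃ λ x → isC c x ≡ true
    someC c neg = count-witness (isC c) (allFin n) (positive (countB E c) (countC E c) (subst (ℤ._< 0ℤ) (cong num (value≡countValue c)) neg))
      where
      positive : ∀ b c → + b ℤ.- + c ℤ.< 0ℤ → 0 ℕ.< c
      positive _ (suc c) _ = ℕ.z<s
      positive b zero    (ℤ.+<+ ())

    module Moves (k : ℕ) (c : Fin n → Color)
      (next : ∀ {A x} → A ≢ uncolored → legal E c A x ≡ true →
              HasValue (myopicColFuel k E (recolor c x A)) (value (recolor c x A))) where

      moves : Color → List (Fin n)
      moves A = filterᵇ (legal E c A) (allFin n)

      OptionHasValue : ∀ A → Fin (length (moves A)) → Val → Set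
      OptionHasValue A i = HasValue (myopicColFuel k E (recolor c (lookup (moves A) i) A))

      legalAt : ∀ A i → legal E c A (lookup (moves A) i) ≡ true
      legalAt A i = Equivalence.to T-≡ (proj₂ (∈-filter⁻ (T? ∘ legal E c A) {xs = allFin n} (∈-lookup i)))

      moveTo : ∀ {A x} {P : Val → Set} → A ≢ uncolored → legal E c A x ≡ true → P (value (recolor c x A)) →
        SomeOption (OptionHasValue A) P
      moveTo {A} {x} A≢u lg p =
        Any.index x∈moves , value (recolor c x A) ,
        subst (λ y → HasValue (myopicColFuel k E (recolor c y A)) (value (recolor c x A)))
              (lookup-index x∈moves) (next A≢u lg) ,
        p
        where
        x∈moves : x ∈ moves A
        x∈moves = ∈-filter⁺ (T? ∘ legal E c A) (∈-allFin x) (Equivalence.from T-≡ lg)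

      blueSide : LeftSide (OptionHasValue blue) (value c)
      blueSide = leftSide below′ unstar′ decrease′
        where
        below′ : ∀ i → Σ Val λ w → OptionHasValue blue i w × w ⧏ value c
        below′ i =
          let lg = legalAt blue i
              (π , change , πcases , _) = recolor-value c blue (proj₁ (legal⇒ lg)) (λ ())
          in _ , next (λ ()) lg ,
             subst (_⧏ value c) (sym change) (+ᵛ-⧏ (value c) (blueMove-⧏0 (legal-contribution (λ ()) lg) πcases))

        unstar′ : nim (value c) ≡ 1ℙ → SomeOption (OptionHasValue blue) (val (num (value c)) 0ℙ ≼_)
        unstar′ odd =
          let (lg , change) = topA-move c blue (λ ()) (topA c (proj₂ (someA c odd)))
          in moveTo (λ ()) lg (inj₂ (sym (trans change (+ᵛ*ᵛ-integer {value c} odd))))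

        decrease′ : nim (value c) ≡ 0ℙ → 0ℤ ℤ.< num (value c) →
          SomeOption (OptionHasValue blue) (val (pred (num (value c))) 0ℙ ≼_)
        decrease′ even pos with find (isA c)
        ... | inj₁ (_ , ax) =
          let (lg , change) = topA-move c blue (λ ()) (topA c ax)
          in moveTo (λ ()) lg (subst (val (pred (num (value c))) 0ℙ ≼_) (sym change) (pred≼+ᵛ*ᵛ (value c)))
        ... | inj₂ noA =
          let (w , bw) = someB c pos ; (cw , toRed) = ∧-true bw
              (s , arc , cs) = hasArcTo-witness c red toRed
              (lg , change) = arc-move c blue (λ ()) noA (==⇒≡ cw) arc cs
          in moveTo (λ ()) lg (inj₂ (sym (trans change (+ᵛ-integer {value c} -1ℤ even))))

      redSide : LeftSide (λ j w → OptionHasValue red j (-ᵛ w)) (-ᵛ value c)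
      redSide = leftSide-negate above unstar′ increase
        where
        above : ∀ j → Σ Val λ w → OptionHasValue red j w × value c ⧏ w
        above j =
          let lg = legalAt red j
              (π , change , πcases , _) = recolor-value c red (proj₁ (legal⇒ lg)) (λ ())
          in _ , next (λ ()) lg ,
             subst (value c ⧏_) (sym change) (⧏-+ᵛ (value c) (redMove-0⧏ (legal-contribution (λ ()) lg) πcases))

        unstar′ : nim (value c) ≡ 1ℙ → SomeOption (OptionHasValue red) (_≼ val (num (value c)) 0ℙ)
        unstar′ odd =
          let (lg , change) = topA-move c red (λ ()) (topA c (proj₂ (someA c odd)))
          in moveTo (λ ()) lg (inj₂ (trans change (+ᵛ*ᵛ-integer {value c} odd)))

        increase : nim (value c) ≡ 0ℙ → num (value c) ℤ.< 0ℤ →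
          SomeOption (OptionHasValue red) (_≼ val (ℤ.suc (num (value c))) 0ℙ)
        increase even neg with find (isA c)
        ... | inj₁ (_ , ax) =
          let (lg , change) = topA-move c red (λ ()) (topA c ax)
          in moveTo (λ ()) lg (subst (_≼ val (ℤ.suc (num (value c))) 0ℙ) (sym change) (+ᵛ*ᵛ≼suc (value c)))
        ... | inj₂ noA =
          let (w , cw′) = someC c neg ; (cw , toBlue) = ∧-true cw′
              (s , arc , cs) = hasArcTo-witness c blue toBlue
              (lg , change) = arc-move c red (λ ()) noA (==⇒≡ cw) arc cs
          in moveTo (λ ()) lg (inj₂ (trans change (+ᵛ-integer {value c} 1ℤ even)))

    -- Each move colors a vertex, so fuel k suffices once at most k vertices are uncolored.
    HasValue-myopicColFuel : ∀ k c → uncoloredCount c ℕ.≤ k → HasValue (myopicColFuel k E c) (value c)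
    HasValue-myopicColFuel zero    c none  = subst (HasValue zeroG) (sym (value-allColored c none)) HasValue-zeroG
    HasValue-myopicColFuel (suc k) c bound = blueSide , redSide
      where
      open Moves k c (λ A≢u lg →
        HasValue-myopicColFuel k _ (ℕₚ.≤-pred (ℕₚ.<-≤-trans (recolor-decreases c _ (proj₁ (legal⇒ lg)) A≢u) bound)))

mainTheorem11 : (n : ℕ) (E : Digraph n) (c : Fin n → Color) →
    IsDisjointUnionOfPaths E →
    myopicCol E c ≈ (times (countA E c) star ⊕ natG (countB E c)) ⊕ neg (natG (countC E c))
mainTheorem11 n E c paths = HasValue⇒≈ (myopicCol E c) _ position formula
  where
  open OnPaths E paths

  position : HasValue (myopicCol E c) (countValue (countA E c) (countB E c) (countC E c))
  position = subst (HasValue _) (value≡countValue E c) (HasValue-myopicColFuel n c (uncoloredCount≤n E c))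

  formula : HasValue ((times (countA E c) star ⊕ natG (countB E c)) ⊕ neg (natG (countC E c)))
                     (countValue (countA E c) (countB E c) (countC E c))
  formula = subst (HasValue _) (formula-countValue (countA E c) (countB E c) (countC E c))
    (HasValue-⊕ _ _ (HasValue-⊕ _ _ (HasValue-times (countA E c) HasValue-star) (HasValue-natG (countB E c)))
                    (HasValue-neg _ (HasValue-natG (countC E c))))
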